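{- Let $\mathbf{V}$ be a variety of Heyting algebras and $L\in\mathbf{V}$ finitely presented. If $\langle u,M\rangle$ is a unifier of $L$ in $\mathbf{V}$, then $\langle\mathcal{B}(u),\mathcal{B}(M)\rangle$ is a unifier of $\mathcal{B}(L)$ in $\rho^*(\mathbf{V})$.
   Context: Interior algebra: Boolean algebra with operator $g$ satisfying $g(1)=1$, $g(xy)=g(x)g(y)$, $g(x)\le x$, $gg(x)=g(x)$. For a Heyting algebra $L$, $\mathcal{B}(L)=\langle\mathrm{Fr}(L),g_L\rangle$ with $\mathrm{Fr}(L)$ the free Boolean extension of $L$ and $g_L((-u_1+v_1)\cdots(-u_n+v_n))=(u_1\Rightarrow v_1)\cdots(u_n\Rightarrow v_n)$; for a Heyting homomorphism $h\colon L\to M$, $\mathcal{B}(h)$ is the unique interior algebra homomorphism $\mathcal{B}(L)\to\mathcal{B}(M)$ extending $h$. $\rho^*(\mathbf{V})$ is the variety generated by $\{\mathcal{B}(L):L\in\mathbf{V}\}$. A unifier of a finitely presented $A$ in a variety $\mathbf{W}$ is a pair $\langle u,B\rangle$ with $B$ finitely presented and projective in $\mathbf{W}$ and $u\colon A\to B$ a homomorphism. -}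

module Defs where

open import Level using (Level; 0ℓ; _⊔_) renaming (suc to lsuc)
open import Data.Nat using (ℕ)
open import Data.Fin using (Fin; zero; suc)
open import Data.List using (List; []; _∷_; _++_; map; foldr; cartesianProductWith)
open import Data.List.Membership.Propositional using (_∈_)
open import Data.Product using (Σ-syntax; _×_; _,_)
open import Data.Vec.Functional using (Vector) renaming ([] to []ᵥ; _∷_ to _∷ᵥ_)
open import Function.Definitions using (Surjective; StrictlyInverseˡ; StrictlyInverseʳ)
open import Relation.Binary using (Rel; IsEquivalence; Poset)
open import Relation.Unary using (Pred)
import Relation.Binary.Reasoning.Setoid as ≈-Reasoning
import Relation.Binary.Lattice.Properties.HeytingAlgebra as HeytingProperties
import Relation.Binary.Lattice.Properties.Lattice as OrderLatticeProperties
import Relation.Binary.Lattice.Properties.MeetSemilattice as MeetProperties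
import Relation.Binary.Lattice.Properties.JoinSemilattice as JoinProperties
import Relation.Binary.Lattice.Properties.DistributiveLattice as OrderDistributiveProperties
import Algebra.Lattice.Properties.BooleanAlgebra as BooleanProperties
open import Algebra.Lattice.Structures.Biased using (isDistributiveLatticeʳʲᵐ; isBooleanAlgebraʳ)
open import Algebra.Lattice.Bundles using (BooleanAlgebra)
open import Relation.Binary.Lattice using (HeytingAlgebra; Lattice)

record Signature : Set₁ where
  field
    Op    : Set
    arity : Op → ℕ

open Signature

record Algebra (S : Signature) (c ℓ : Level) : Set (lsuc (c ⊔ ℓ)) where
  infix 4 _≈_
  field
    Carrier       : Set c
    _≈_           : Rel Carrier ℓ
    isEquivalence : IsEquivalence _≈_
    op            : (o : Op S) → Vector Carrier (arity S o) → Carrier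
    op-cong       : ∀ o {xs ys} → (∀ i → xs i ≈ ys i) → op o xs ≈ op o ys

  open IsEquivalence isEquivalence public

record Hom {S : Signature} {a ℓ₁ b ℓ₂ : Level}
           (A : Algebra S a ℓ₁) (B : Algebra S b ℓ₂) : Set (a ⊔ ℓ₁ ⊔ b ⊔ ℓ₂) where
  private
    module A = Algebra A
    module B = Algebra B
  field
    fun  : A.Carrier → B.Carrier
    cong : ∀ {x y} → x A.≈ y → fun x B.≈ fun y
    homo : ∀ o xs → fun (A.op o xs) B.≈ B.op o (λ i → fun (xs i))

infix 4 _≅_

record _≅_ {S : Signature} {a ℓ₁ b ℓ₂ : Level}
           (A : Algebra S a ℓ₁) (B : Algebra S b ℓ₂) : Set (a ⊔ ℓ₁ ⊔ b ⊔ ℓ₂) where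
  field
    to       : Hom A B
    from     : Hom B A
    inverseˡ : StrictlyInverseˡ (Algebra._≈_ B) (Hom.fun to) (Hom.fun from)
    inverseʳ : StrictlyInverseʳ (Algebra._≈_ A) (Hom.fun to) (Hom.fun from)

data Term (S : Signature) (X : Set) : Set where
  var  : X → Term S X
  node : (o : Op S) → Vector (Term S X) (arity S o) → Term S X

module _ {S : Signature} {c ℓ : Level} (A : Algebra S c ℓ) where
  open Algebra A

  eval : {X : Set} → (X → Carrier) → Term S X → Carrier
  eval ρ (var x)     = ρ x
  eval ρ (node o ts) = op o (λ i → eval ρ (ts i))

  -- The congruence of A generated by a finite set of pairs.
  data Cg (R : List (Carrier × Carrier)) : Rel Carrier (c ⊔ ℓ) where
    base  : ∀ {x y} → x ≈ y → Cg R x y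
    rel   : ∀ {x y} → (x , y) ∈ R → Cg R x y
    symm  : ∀ {x y} → Cg R x y → Cg R y x
    tran  : ∀ {x y z} → Cg R x y → Cg R y z → Cg R x z
    congr : ∀ o {xs ys} → (∀ i → Cg R (xs i) (ys i)) → Cg R (op o xs) (op o ys)

  infixl 6 _/_

  _/_ : List (Carrier × Carrier) → Algebra S c (c ⊔ ℓ)
  _/_ R = record
    { Carrier       = Carrier
    ; _≈_           = Cg R
    ; isEquivalence = record { refl = base refl ; sym = symm ; trans = tran }
    ; op            = op
    ; op-cong       = congr
    }

-- A kind of structure (Heyting algebras, interior algebras, ...) together with
-- the algebra underlying each such structure, all in the universe ℓ of sets.
record Kind (ℓ : Level) : Set (lsuc (lsuc ℓ)) where
  field
    sig : Signature
    Str : Set (lsuc ℓ)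
    alg : Str → Algebra sig ℓ ℓ

module _ {ℓ : Level} (K : Kind ℓ) where
  open Kind K

  Identity : Set
  Identity = Term sig ℕ × Term sig ℕ

  infix 4 _⊨_

  _⊨_ : Str → Identity → Set ℓ
  A ⊨ (s , t) = ∀ ρ → Algebra._≈_ (alg A) (eval (alg A) ρ s) (eval (alg A) ρ t)

  -- A variety is an equational class, given by a set of defining identities.
  Variety : (e : Level) → Set (lsuc e)
  Variety e = Pred Identity e

  infix 4 _∈ᵥ_

  _∈ᵥ_ : {e : Level} → Str → Variety e → Set (ℓ ⊔ e)
  A ∈ᵥ W = ∀ p → W p → A ⊨ p

  -- The smallest variety containing C: its defining identities are those
  -- that hold throughout C.
  generatedBy : {e : Level} → Pred Str e → Variety (lsuc ℓ ⊔ e)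
  generatedBy C p = ∀ A → C A → A ⊨ p

  generatedBy-contains : {e : Level} (C : Pred Str e) → ∀ {A} → C A → A ∈ᵥ generatedBy C
  generatedBy-contains C {A} A∈C p hp = hp A A∈C

  generatedBy-least : {e e′ : Level} (C : Pred Str e) (W : Variety e′) →
                      (∀ {A} → C A → A ∈ᵥ W) → ∀ {A} → A ∈ᵥ generatedBy C → A ∈ᵥ W
  generatedBy-least C W C⊆W A∈C p p∈W = A∈C p (λ B B∈C → C⊆W B∈C p p∈W)

  module _ {e : Level} (W : Variety e) where

    -- The free algebra of W on n generators: terms modulo the equations
    -- that are valid in every member of W.
    Free : ℕ → Algebra sig 0ℓ (lsuc ℓ ⊔ e)
    Free n = record
      { Carrier       = Term sig (Fin n)
      ; _≈_           = λ s t → ∀ A → A ∈ᵥ W → ∀ ρ →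
                          Algebra._≈_ (alg A) (eval (alg A) ρ s) (eval (alg A) ρ t)
      ; isEquivalence = record
        { refl  = λ A _ _ → Algebra.refl (alg A)
        ; sym   = λ s≈t A A∈W ρ → Algebra.sym (alg A) (s≈t A A∈W ρ)
        ; trans = λ s≈t t≈u A A∈W ρ → Algebra.trans (alg A) (s≈t A A∈W ρ) (t≈u A A∈W ρ)
        }
      ; op            = node
      ; op-cong       = λ o ss≈ts A A∈W ρ →
                          Algebra.op-cong (alg A) o (λ i → ss≈ts i A A∈W ρ)
      }

    FinitelyPresented : Pred Str (lsuc ℓ ⊔ e)
    FinitelyPresented A =
      Σ[ n ∈ ℕ ] Σ[ R ∈ List (Term sig (Fin n) × Term sig (Fin n)) ] alg A ≅ Free n / R

    Projective : Pred Str (lsuc ℓ ⊔ e)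
    Projective P =
      ∀ A B → A ∈ᵥ W → B ∈ᵥ W →
      (f : Hom (alg A) (alg B)) →
      Surjective (Algebra._≈_ (alg A)) (Algebra._≈_ (alg B)) (Hom.fun f) →
      (h : Hom (alg P) (alg B)) →
      Σ[ k ∈ Hom (alg P) (alg A) ]
        (∀ x → Algebra._≈_ (alg B) (Hom.fun f (Hom.fun k x)) (Hom.fun h x))

    -- Unifiers are only considered for finitely presented members A of W, so
    -- that requirement is part of the notion.
    record IsUnifier (A B : Str) (u : Hom (alg A) (alg B)) : Set (lsuc ℓ ⊔ e) where
      field
        dom-member            : A ∈ᵥ W
        dom-finitelyPresented : FinitelyPresented A
        cod-member            : B ∈ᵥ W
        cod-finitelyPresented : FinitelyPresented B
        cod-projective        : Projective B

data HeytingOp : Set where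
  `∧ `∨ `⇨ `⊤ `⊥ : HeytingOp

heytingSignature : Signature
heytingSignature = record
  { Op    = HeytingOp
  ; arity = λ { `∧ → 2 ; `∨ → 2 ; `⇨ → 2 ; `⊤ → 0 ; `⊥ → 0 }
  }

heytingAlg : {c ℓ₁ ℓ₂ : Level} → HeytingAlgebra c ℓ₁ ℓ₂ → Algebra heytingSignature c ℓ₁
heytingAlg L = record
  { Carrier       = Carrier
  ; _≈_           = _≈_
  ; isEquivalence = isEquivalence
  ; op            = λ where
      `∧ xs → xs zero ∧ xs (suc zero)
      `∨ xs → xs zero ∨ xs (suc zero)
      `⇨ xs → xs zero ⇨ xs (suc zero)
      `⊤ _  → ⊤
      `⊥ _  → ⊥
  ; op-cong       = λ where
      `∧ p → MeetProperties.∧-cong meetSemilattice (p zero) (p (suc zero))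
      `∨ p → JoinProperties.∨-cong joinSemilattice (p zero) (p (suc zero))
      `⇨ p → HeytingProperties.⇨-cong L (p zero) (p (suc zero))
      `⊤ _ → Eq.refl
      `⊥ _ → Eq.refl
  }
  where open HeytingAlgebra L

HeytingAlgebras : (ℓ : Level) → Kind ℓ
HeytingAlgebras ℓ = record
  { sig = heytingSignature ; Str = HeytingAlgebra ℓ ℓ ℓ ; alg = heytingAlg }

HeytingHom : {a ℓ₁ ℓ₂ b ℓ₃ ℓ₄ : Level} →
             HeytingAlgebra a ℓ₁ ℓ₂ → HeytingAlgebra b ℓ₃ ℓ₄ → Set (a ⊔ ℓ₁ ⊔ b ⊔ ℓ₃)
HeytingHom L M = Hom (heytingAlg L) (heytingAlg M)

record InteriorAlgebra (c ℓ : Level) : Set (lsuc (c ⊔ ℓ)) where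
  field
    booleanAlgebra : BooleanAlgebra c ℓ

  open BooleanAlgebra booleanAlgebra public
  open Poset (BooleanProperties.poset booleanAlgebra) public using (_≤_)

  field
    g      : Carrier → Carrier
    g-cong : ∀ {x y} → x ≈ y → g x ≈ g y
    g-⊤    : g ⊤ ≈ ⊤
    g-∧    : ∀ x y → g (x ∧ y) ≈ g x ∧ g y
    g-≤    : ∀ x → g x ≤ x
    g-idem : ∀ x → g (g x) ≈ g x

data InteriorOp : Set where
  `∧ `∨ `¬ `⊤ `⊥ `g : InteriorOp

interiorSignature : Signature
interiorSignature = record
  { Op    = InteriorOp
  ; arity = λ { `∧ → 2 ; `∨ → 2 ; `¬ → 1 ; `⊤ → 0 ; `⊥ → 0 ; `g → 1 }
  }

interiorAlg : {c ℓ : Level} → InteriorAlgebra c ℓ → Algebra interiorSignature c ℓ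
interiorAlg A = record
  { Carrier       = Carrier
  ; _≈_           = _≈_
  ; isEquivalence = isEquivalence
  ; op            = λ where
      `∧ xs → xs zero ∧ xs (suc zero)
      `∨ xs → xs zero ∨ xs (suc zero)
      `¬ xs → ¬ xs zero
      `⊤ _  → ⊤
      `⊥ _  → ⊥
      `g xs → g (xs zero)
  ; op-cong       = λ where
      `∧ p → ∧-cong (p zero) (p (suc zero))
      `∨ p → ∨-cong (p zero) (p (suc zero))
      `¬ p → ¬-cong (p zero)
      `⊤ _ → refl
      `⊥ _ → refl
      `g p → g-cong (p zero)
  }
  where open InteriorAlgebra A

InteriorAlgebras : (ℓ : Level) → Kind ℓ
InteriorAlgebras ℓ = record
  { sig = interiorSignature ; Str = InteriorAlgebra ℓ ℓ ; alg = interiorAlg }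

InteriorHom : {a ℓ₁ b ℓ₂ : Level} →
              InteriorAlgebra a ℓ₁ → InteriorAlgebra b ℓ₂ → Set (a ⊔ ℓ₁ ⊔ b ⊔ ℓ₂)
InteriorHom A B = Hom (interiorAlg A) (interiorAlg B)

-- Homomorphisms of bounded lattices from (the lattice reduct of) L.
record LatticeHom {a ℓ₁ ℓ₂ b ℓ₃ : Level}
                  (L : HeytingAlgebra a ℓ₁ ℓ₂) (A : BooleanAlgebra b ℓ₃)
                  : Set (a ⊔ ℓ₁ ⊔ b ⊔ ℓ₃) where
  private
    module L = HeytingAlgebra L
    module A = BooleanAlgebra A
  field
    fun    : L.Carrier → A.Carrier
    cong   : ∀ {x y} → x L.≈ y → fun x A.≈ fun y
    ∧-homo : ∀ x y → fun (x L.∧ y) A.≈ fun x A.∧ fun y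
    ∨-homo : ∀ x y → fun (x L.∨ y) A.≈ fun x A.∨ fun y
    ⊤-homo : fun L.⊤ A.≈ A.⊤
    ⊥-homo : fun L.⊥ A.≈ A.⊥

module FreeBooleanExtension {c ℓ₁ ℓ₂ : Level} (L : HeytingAlgebra c ℓ₁ ℓ₂) where
  private
    module L = HeytingAlgebra L
    module LP = HeytingProperties L
    module LM = MeetProperties L.meetSemilattice
    module LJ = JoinProperties L.joinSemilattice
    module LL = OrderLatticeProperties L.lattice
    module LD = OrderDistributiveProperties LP.distributiveLattice

  infix  8 ¬_
  infixr 7 _∧_
  infixr 6 _∨_
  infix  4 _≋_

  -- Fr(L) is the Boolean algebra generated by the elements of L subject to
  -- the relations making ι a homomorphism of bounded lattices.
  data Fr : Set c where
    ι       : L.Carrier → Fr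
    _∧_ _∨_ : Fr → Fr → Fr
    ¬_      : Fr → Fr
    ⊤ ⊥     : Fr

  data _≋_ : Rel Fr (c ⊔ ℓ₁) where
    ≋-refl  : ∀ {x} → x ≋ x
    ≋-sym   : ∀ {x y} → x ≋ y → y ≋ x
    ≋-trans : ∀ {x y z} → x ≋ y → y ≋ z → x ≋ z
    ∧-cong  : ∀ {x y u v} → x ≋ y → u ≋ v → x ∧ u ≋ y ∧ v
    ∨-cong  : ∀ {x y u v} → x ≋ y → u ≋ v → x ∨ u ≋ y ∨ v
    ¬-cong  : ∀ {x y} → x ≋ y → ¬ x ≋ ¬ y
    ∧-comm  : ∀ x y → x ∧ y ≋ y ∧ x
    ∨-comm  : ∀ x y → x ∨ y ≋ y ∨ x
    ∧-assoc : ∀ x y z → (x ∧ y) ∧ z ≋ x ∧ (y ∧ z)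
    ∨-assoc : ∀ x y z → (x ∨ y) ∨ z ≋ x ∨ (y ∨ z)
    ∨-absorbs-∧  : ∀ x y → x ∨ (x ∧ y) ≋ x
    ∧-absorbs-∨  : ∀ x y → x ∧ (x ∨ y) ≋ x
    ∨-distribʳ-∧ : ∀ x y z → (y ∧ z) ∨ x ≋ (y ∨ x) ∧ (z ∨ x)
    ∨-complementʳ : ∀ x → x ∨ ¬ x ≋ ⊤
    ∧-complementʳ : ∀ x → x ∧ ¬ x ≋ ⊥
    ι-cong : ∀ {a b} → a L.≈ b → ι a ≋ ι b
    ι-∧ : ∀ a b → ι (a L.∧ b) ≋ ι a ∧ ι b
    ι-∨ : ∀ a b → ι (a L.∨ b) ≋ ι a ∨ ι b
    ι-⊤ : ι L.⊤ ≋ ⊤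
    ι-⊥ : ι L.⊥ ≋ ⊥

  frBoolean : BooleanAlgebra c (c ⊔ ℓ₁)
  frBoolean = record
    { Carrier = Fr ; _≈_ = _≋_ ; _∨_ = _∨_ ; _∧_ = _∧_ ; ¬_ = ¬_ ; ⊤ = ⊤ ; ⊥ = ⊥
    ; isBooleanAlgebra = isBooleanAlgebraʳ record
      { isDistributiveLattice = isDistributiveLatticeʳʲᵐ record
        { isLattice = record
          { isEquivalence = record { refl = ≋-refl ; sym = ≋-sym ; trans = ≋-trans }
          ; ∨-comm = ∨-comm ; ∨-assoc = ∨-assoc ; ∨-cong = ∨-cong
          ; ∧-comm = ∧-comm ; ∧-assoc = ∧-assoc ; ∧-cong = ∧-cong
          ; absorptive = ∨-absorbs-∧ , ∧-absorbs-∨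
          }
        ; ∨-distribʳ-∧ = ∨-distribʳ-∧
        }
      ; ∨-complementʳ = ∨-complementʳ
      ; ∧-complementʳ = ∧-complementʳ
      ; ¬-cong = ¬-cong
      }
    }

  module _ {a ℓ : Level} (A : BooleanAlgebra a ℓ) (f : LatticeHom L A) where
    private
      module A = BooleanAlgebra A
      module f = LatticeHom f

    extend : Fr → A.Carrier
    extend (ι a)   = f.fun a
    extend (x ∧ y) = extend x A.∧ extend y
    extend (x ∨ y) = extend x A.∨ extend y
    extend (¬ x)   = A.¬ extend x
    extend ⊤       = A.⊤
    extend ⊥       = A.⊥

    extend-cong : ∀ {x y} → x ≋ y → extend x A.≈ extend y
    extend-cong ≋-refl          = A.refl
    extend-cong (≋-sym p)       = A.sym (extend-cong p)
    extend-cong (≋-trans p q)   = A.trans (extend-cong p) (extend-cong q)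
    extend-cong (∧-cong p q)    = A.∧-cong (extend-cong p) (extend-cong q)
    extend-cong (∨-cong p q)    = A.∨-cong (extend-cong p) (extend-cong q)
    extend-cong (¬-cong p)      = A.¬-cong (extend-cong p)
    extend-cong (∧-comm x y)    = A.∧-comm _ _
    extend-cong (∨-comm x y)    = A.∨-comm _ _
    extend-cong (∧-assoc x y z) = A.∧-assoc _ _ _
    extend-cong (∨-assoc x y z) = A.∨-assoc _ _ _
    extend-cong (∨-absorbs-∧ x y)    = A.∨-absorbs-∧ _ _
    extend-cong (∧-absorbs-∨ x y)    = A.∧-absorbs-∨ _ _
    extend-cong (∨-distribʳ-∧ x y z) = A.∨-distribʳ-∧ _ _ _
    extend-cong (∨-complementʳ x)    = A.∨-complementʳ _
    extend-cong (∧-complementʳ x)    = A.∧-complementʳ _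
    extend-cong (ι-cong p) = f.cong p
    extend-cong (ι-∧ a b)  = f.∧-homo a b
    extend-cong (ι-∨ a b)  = f.∨-homo a b
    extend-cong ι-⊤        = f.⊤-homo
    extend-cong ι-⊥        = f.⊥-homo

  -- For v in L, the Boolean algebra of v-regular elements ((a ⇨ v) ⇨ v = a),
  -- presented as a quotient of L.  It separates v from the elements not below
  -- it, so that ι is an order embedding.
  module Regular (v : L.Carrier) where

    infix 4 _~_
    _~_ : Rel L.Carrier ℓ₁
    a ~ b = (a L.⇨ v) L.≈ (b L.⇨ v)

    ≈⇒~ : ∀ {a b} → a L.≈ b → a ~ b
    ≈⇒~ p = LP.⇨-cong p L.Eq.refl

    private
      ⇨-swap : ∀ a b → ((a L.∧ b) L.⇨ v) L.≈ (b L.⇨ (a L.⇨ v))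
      ⇨-swap a b = L.Eq.trans (≈⇒~ (LM.∧-comm a b)) LP.⇨-curry

      ~-∧ : ∀ {a b x y} → a ~ b → x ~ y → a L.∧ x ~ b L.∧ y
      ~-∧ {a} {b} {x} {y} p q = begin
        (a L.∧ x) L.⇨ v   ≈⟨ LP.⇨-curry ⟩
        a L.⇨ (x L.⇨ v)   ≈⟨ LP.⇨-cong L.Eq.refl q ⟩
        a L.⇨ (y L.⇨ v)   ≈⟨ ⇨-swap y a ⟨
        (y L.∧ a) L.⇨ v   ≈⟨ LP.⇨-curry ⟩
        y L.⇨ (a L.⇨ v)   ≈⟨ LP.⇨-cong L.Eq.refl p ⟩
        y L.⇨ (b L.⇨ v)   ≈⟨ ⇨-swap b y ⟨
        (b L.∧ y) L.⇨ v   ∎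
        where open ≈-Reasoning L.setoid

      ~-∨ : ∀ {a b x y} → a ~ b → x ~ y → a L.∨ x ~ b L.∨ y
      ~-∨ p q = L.Eq.trans (LP.⇨-distribˡ-∨-∧ _ _ _)
        (L.Eq.trans (LM.∧-cong p q) (L.Eq.sym (LP.⇨-distribˡ-∨-∧ _ _ _)))

      ~-lem : ∀ a → a L.∨ (a L.⇨ v) ~ L.⊤
      ~-lem a = L.antisym
        (L.trans (L.reflexive (LP.⇨-distribˡ-∨-∧ _ _ _))
          (L.trans (LP.⇨-applyʳ L.refl) LP.y≤x⇨y))
        (LP.⇨ˡ-contravariant (L.maximum _))

      ~-contra : ∀ a → a L.∧ (a L.⇨ v) ~ L.⊥
      ~-contra a = L.antisym
        (LP.⇨ˡ-contravariant (L.minimum _))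
        (L.transpose-⇨ (L.trans (L.x∧y≤y _ _) (LP.⇨-applyʳ L.refl)))

    regular : BooleanAlgebra c ℓ₁
    regular = record
      { Carrier = L.Carrier ; _≈_ = _~_ ; _∨_ = L._∨_ ; _∧_ = L._∧_
      ; ¬_ = L._⇨ v ; ⊤ = L.⊤ ; ⊥ = L.⊥
      ; isBooleanAlgebra = isBooleanAlgebraʳ record
        { isDistributiveLattice = isDistributiveLatticeʳʲᵐ record
          { isLattice = record
            { isEquivalence = record
              { refl = L.Eq.refl ; sym = L.Eq.sym ; trans = L.Eq.trans }
            ; ∨-comm  = λ x y → ≈⇒~ (LJ.∨-comm x y)
            ; ∨-assoc = λ x y z → ≈⇒~ (LJ.∨-assoc x y z)
            ; ∨-cong  = ~-∨
            ; ∧-comm  = λ x y → ≈⇒~ (LM.∧-comm x y)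
            ; ∧-assoc = λ x y z → ≈⇒~ (LM.∧-assoc x y z)
            ; ∧-cong  = ~-∧
            ; absorptive = (λ x y → ≈⇒~ (LL.∨-absorbs-∧ x y))
                         , (λ x y → ≈⇒~ (LL.∧-absorbs-∨ x y))
            }
          ; ∨-distribʳ-∧ = λ x y z → ≈⇒~ (LD.∨-distribʳ-∧ x y z)
          }
        ; ∨-complementʳ = ~-lem
        ; ∧-complementʳ = ~-contra
        ; ¬-cong = λ p → LP.⇨-cong p L.Eq.refl
        }
      }

    quotient : LatticeHom L regular
    quotient = record
      { fun = λ a → a ; cong = ≈⇒~
      ; ∧-homo = λ _ _ → L.Eq.refl ; ∨-homo = λ _ _ → L.Eq.refl
      ; ⊤-homo = L.Eq.refl ; ⊥-homo = L.Eq.refl }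

  private
    module F = BooleanAlgebra frBoolean
    module FP = BooleanProperties frBoolean
    module FO = Lattice FP.∨-∧-orderTheoreticLattice

  infix 4 _≤_
  _≤_ : Rel Fr (c ⊔ ℓ₁)
  _≤_ = Poset._≤_ FP.poset

  ι-mono : ∀ {a b} → a L.≤ b → ι a ≤ ι b
  ι-mono {a} {b} a≤b = ≋-trans
    (ι-cong (L.antisym (L.∧-greatest L.refl a≤b) (L.x∧y≤x a b))) (ι-∧ a b)

  ι-reflects-≤ : ∀ {a b} → ι a ≤ ι b → a L.≤ b
  ι-reflects-≤ {a} {b} p = L.trans (L.∧-greatest L.refl (L.trans (L.maximum a) top)) ⇨b
    where
    q : (a L.⇨ b) L.≈ ((a L.∧ b) L.⇨ b)
    q = extend-cong (Regular.regular b) (Regular.quotient b) p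
    top : L.⊤ L.≤ (a L.⇨ b)
    top = L.trans (L.transpose-⇨ (L.trans (L.x∧y≤y _ _) (L.x∧y≤y a b)))
                  (L.reflexive (L.Eq.sym q))
    ⇨b : a L.∧ (a L.⇨ b) L.≤ b
    ⇨b = LP.⇨-applyʳ L.refl

  ι-injective : ∀ {a b} → ι a ≋ ι b → a L.≈ b
  ι-injective p = L.antisym (ι-reflects-≤ (FO.reflexive p)) (ι-reflects-≤ (FO.reflexive (≋-sym p)))

  -- A list (u₁ , v₁) ∷ … ∷ (uₙ , vₙ) ∷ [] stands for (-u₁+v₁)⋯(-uₙ+vₙ).
  Clauses : Set c
  Clauses = List (L.Carrier × L.Carrier)

  clause : L.Carrier × L.Carrier → Fr
  clause (u , v) = ¬ ι u ∨ ι v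

  ∏ : Clauses → Fr
  ∏ = foldr (λ p x → clause p ∧ x) ⊤

  ∏⇨ : Clauses → L.Carrier
  ∏⇨ = foldr (λ (u , v) a → (u L.⇨ v) L.∧ a) L.⊤

  private
    merge : L.Carrier × L.Carrier → L.Carrier × L.Carrier → L.Carrier × L.Carrier
    merge (u , v) (u′ , v′) = u L.∧ u′ , v L.∨ v′

    _⊗_ : Clauses → Clauses → Clauses
    _⊗_ = cartesianProductWith merge

  -- Conjunctive normal forms of x and of ¬ x.
  mutual
    cnf : Fr → Clauses
    cnf (ι a)   = (L.⊤ , a) ∷ []
    cnf (x ∧ y) = cnf x ++ cnf y
    cnf (x ∨ y) = cnf x ⊗ cnf y
    cnf (¬ x)   = cnf¬ x
    cnf ⊤       = []
    cnf ⊥       = (L.⊤ , L.⊥) ∷ []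

    cnf¬ : Fr → Clauses
    cnf¬ (ι a)   = (a , L.⊥) ∷ []
    cnf¬ (x ∧ y) = cnf¬ x ⊗ cnf¬ y
    cnf¬ (x ∨ y) = cnf¬ x ++ cnf¬ y
    cnf¬ (¬ x)   = cnf x
    cnf¬ ⊤       = (L.⊤ , L.⊥) ∷ []
    cnf¬ ⊥       = []

  private
    open ≈-Reasoning F.setoid

    ∏-++ : ∀ cs ds → ∏ (cs ++ ds) ≋ ∏ cs ∧ ∏ ds
    ∏-++ []       ds = ≋-sym (FP.∧-identityˡ _)
    ∏-++ (c ∷ cs) ds = ≋-trans (∧-cong ≋-refl (∏-++ cs ds)) (≋-sym (∧-assoc _ _ _))

    clause-merge : ∀ p q → clause (merge p q) ≋ clause p ∨ clause q
    clause-merge (u , v) (u′ , v′) = begin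
      ¬ ι (u L.∧ u′) ∨ ι (v L.∨ v′)
        ≈⟨ ∨-cong (≋-trans (¬-cong (ι-∧ u u′)) (FP.deMorgan₁ _ _)) (ι-∨ v v′) ⟩
      (¬ ι u ∨ ¬ ι u′) ∨ (ι v ∨ ι v′)  ≈⟨ ∨-assoc _ _ _ ⟩
      ¬ ι u ∨ (¬ ι u′ ∨ (ι v ∨ ι v′))  ≈⟨ ∨-cong ≋-refl (∨-assoc _ _ _) ⟨
      ¬ ι u ∨ ((¬ ι u′ ∨ ι v) ∨ ι v′)  ≈⟨ ∨-cong ≋-refl (∨-cong (∨-comm _ _) ≋-refl) ⟩
      ¬ ι u ∨ ((ι v ∨ ¬ ι u′) ∨ ι v′)  ≈⟨ ∨-cong ≋-refl (∨-assoc _ _ _) ⟩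
      ¬ ι u ∨ (ι v ∨ (¬ ι u′ ∨ ι v′))  ≈⟨ ∨-assoc _ _ _ ⟨
      (¬ ι u ∨ ι v) ∨ (¬ ι u′ ∨ ι v′)  ∎

    ∏-map-merge : ∀ p ds → ∏ (map (merge p) ds) ≋ clause p ∨ ∏ ds
    ∏-map-merge p []       = ≋-sym (FP.∨-zeroʳ _)
    ∏-map-merge p (q ∷ ds) = ≋-trans (∧-cong (clause-merge p q) (∏-map-merge p ds))
                                     (≋-sym (F.∨-distribˡ-∧ _ _ _))

    ∏-⊗ : ∀ cs ds → ∏ (cs ⊗ ds) ≋ ∏ cs ∨ ∏ ds
    ∏-⊗ []       ds = ≋-sym (FP.∨-zeroˡ _)
    ∏-⊗ (p ∷ cs) ds = begin
      ∏ (map (merge p) ds ++ (cs ⊗ ds))      ≈⟨ ∏-++ (map (merge p) ds) (cs ⊗ ds) ⟩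
      ∏ (map (merge p) ds) ∧ ∏ (cs ⊗ ds)     ≈⟨ ∧-cong (∏-map-merge p ds) (∏-⊗ cs ds) ⟩
      (clause p ∨ ∏ ds) ∧ (∏ cs ∨ ∏ ds)      ≈⟨ ∨-distribʳ-∧ _ _ _ ⟨
      (clause p ∧ ∏ cs) ∨ ∏ ds               ∎

    unit-clause : ∀ a → ∏ ((L.⊤ , a) ∷ []) ≋ ι a
    unit-clause a = begin
      (¬ ι L.⊤ ∨ ι a) ∧ ⊤  ≈⟨ FP.∧-identityʳ _ ⟩
      ¬ ι L.⊤ ∨ ι a        ≈⟨ ∨-cong (≋-trans (¬-cong ι-⊤) FP.¬⊤≈⊥) ≋-refl ⟩
      ⊥ ∨ ι a              ≈⟨ FP.∨-identityˡ _ ⟩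
      ι a                  ∎

  mutual
    ∏-cnf : ∀ x → ∏ (cnf x) ≋ x
    ∏-cnf (ι a)   = unit-clause a
    ∏-cnf (x ∧ y) = ≋-trans (∏-++ (cnf x) (cnf y)) (∧-cong (∏-cnf x) (∏-cnf y))
    ∏-cnf (x ∨ y) = ≋-trans (∏-⊗ (cnf x) (cnf y)) (∨-cong (∏-cnf x) (∏-cnf y))
    ∏-cnf (¬ x)   = ∏-cnf¬ x
    ∏-cnf ⊤       = ≋-refl
    ∏-cnf ⊥       = ≋-trans (unit-clause L.⊥) ι-⊥

    ∏-cnf¬ : ∀ x → ∏ (cnf¬ x) ≋ ¬ x
    ∏-cnf¬ (ι a)   = begin
      (¬ ι a ∨ ι L.⊥) ∧ ⊤  ≈⟨ FP.∧-identityʳ _ ⟩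
      ¬ ι a ∨ ι L.⊥        ≈⟨ ∨-cong ≋-refl ι-⊥ ⟩
      ¬ ι a ∨ ⊥            ≈⟨ FP.∨-identityʳ _ ⟩
      ¬ ι a                ∎
    ∏-cnf¬ (x ∧ y) = ≋-trans (∏-⊗ (cnf¬ x) (cnf¬ y))
      (≋-trans (∨-cong (∏-cnf¬ x) (∏-cnf¬ y)) (≋-sym (FP.deMorgan₁ x y)))
    ∏-cnf¬ (x ∨ y) = ≋-trans (∏-++ (cnf¬ x) (cnf¬ y))
      (≋-trans (∧-cong (∏-cnf¬ x) (∏-cnf¬ y)) (≋-sym (FP.deMorgan₂ x y)))
    ∏-cnf¬ (¬ x)   = ≋-trans (∏-cnf x) (≋-sym (FP.¬-involutive x))
    ∏-cnf¬ ⊤       = ≋-trans (unit-clause L.⊥) (≋-trans ι-⊥ (≋-sym FP.¬⊤≈⊥))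
    ∏-cnf¬ ⊥       = ≋-sym FP.¬⊥≈⊤

  private
    below-clause : ∀ {a u v} → ι a ≤ clause (u , v) → a L.≤ (u L.⇨ v)
    below-clause {a} {u} {v} p = L.transpose-⇨ (ι-reflects-≤
      (FO.trans (FO.reflexive (ι-∧ a u))
      (FO.trans (FO.∧-greatest (FO.trans (FO.x∧y≤x _ _) p) (FO.x∧y≤y _ _))
      (FO.trans (FO.reflexive (F.∧-distribʳ-∨ _ _ _))
      (FO.∨-least
        (FO.trans (FO.reflexive (F.∧-complementˡ _))
                  (FO.trans (FO.reflexive (≋-sym ι-⊥)) (ι-mono (L.minimum v))))
        (FO.x∧y≤x _ _))))))

    above-clause : ∀ {a u v} → a L.≤ (u L.⇨ v) → ι a ≤ clause (u , v)
    above-clause {a} {u} {v} p =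
      FO.trans (FO.reflexive (≋-sym (FP.∧-identityʳ _)))
      (FO.trans (FO.reflexive (∧-cong ≋-refl (≋-sym (F.∨-complementˡ (ι u)))))
      (FO.trans (FO.reflexive (F.∧-distribˡ-∨ _ _ _))
      (FO.∨-least
        (FO.trans (FO.x∧y≤y _ _) (FO.x≤x∨y _ _))
        (FO.trans (FO.reflexive (≋-sym (ι-∧ a u)))
                  (FO.trans (ι-mono (L.transpose-∧ p)) (FO.y≤x∨y _ _))))))

    below-∏ : ∀ {a} cs → ι a ≤ ∏ cs → a L.≤ ∏⇨ cs
    below-∏ []       _ = L.maximum _
    below-∏ (c ∷ cs) p = L.∧-greatest (below-clause (FO.trans p (FO.x∧y≤x _ _)))
                                      (below-∏ cs (FO.trans p (FO.x∧y≤y _ _)))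

    above-∏ : ∀ {a} cs → a L.≤ ∏⇨ cs → ι a ≤ ∏ cs
    above-∏ []       _ = ≋-sym (FP.∧-identityʳ _)
    above-∏ (c ∷ cs) p = FO.∧-greatest (above-clause (L.trans p (L.x∧y≤x _ _)))
                                       (above-∏ cs (L.trans p (L.x∧y≤y _ _)))

  interior : Fr → L.Carrier
  interior x = ∏⇨ (cnf x)

  interior-greatest : ∀ {a x} → ι a ≤ x → a L.≤ interior x
  interior-greatest {a} {x} p = below-∏ (cnf x) (FO.trans p (FO.reflexive (≋-sym (∏-cnf x))))

  interior-below : ∀ {a x} → a L.≤ interior x → ι a ≤ x
  interior-below {a} {x} p = FO.trans (above-∏ (cnf x) p) (FO.reflexive (∏-cnf x))

  interior-mono : ∀ {x y} → x ≤ y → interior x L.≤ interior y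
  interior-mono p = interior-greatest (FO.trans (interior-below L.refl) p)

  interior-cong : ∀ {x y} → x ≋ y → interior x L.≈ interior y
  interior-cong p = L.antisym (interior-mono (FO.reflexive p))
                              (interior-mono (FO.reflexive (≋-sym p)))

  interior-ι : ∀ a → interior (ι a) L.≈ a
  interior-ι a = L.antisym (ι-reflects-≤ (interior-below L.refl)) (interior-greatest FO.refl)

  interior-∏ : ∀ cs → interior (∏ cs) L.≈ ∏⇨ cs
  interior-∏ cs = L.antisym (below-∏ cs (interior-below L.refl))
                            (interior-greatest (above-∏ cs L.refl))

  gL : Fr → Fr
  gL x = ι (interior x)

  -- The defining formula of g_L, for arbitrary representations of the argument.
  gL-formula : ∀ cs → gL (∏ cs) ≋ ι (∏⇨ cs)
  gL-formula cs = ι-cong (interior-∏ cs)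

  gL-∧ : ∀ x y → gL (x ∧ y) ≋ gL x ∧ gL y
  gL-∧ x y = FO.antisym
    (FO.∧-greatest (ι-mono (interior-mono {x ∧ y} {x} (FO.x∧y≤x x y)))
                   (ι-mono (interior-mono {x ∧ y} {y} (FO.x∧y≤y x y))))
    (FO.trans (FO.reflexive (≋-sym (ι-∧ _ _))) (ι-mono (interior-greatest {x = x ∧ y}
      (FO.trans (FO.reflexive (ι-∧ _ _))
        (FO.∧-greatest (FO.trans (FO.x∧y≤x _ _) (interior-below {x = x} L.refl))
                       (FO.trans (FO.x∧y≤y _ _) (interior-below {x = y} L.refl)))))))

open FreeBooleanExtension using (ι; _∧_; _∨_; ¬_; ⊤; ⊥)

𝓑 : {c ℓ₁ ℓ₂ : Level} → HeytingAlgebra c ℓ₁ ℓ₂ → InteriorAlgebra c (c ⊔ ℓ₁)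
𝓑 L = record
  { booleanAlgebra = frBoolean
  ; g      = gL
  ; g-cong = λ {x} {y} p → ι-cong (interior-cong {x} {y} p)
  ; g-⊤    = ι-⊤
  ; g-∧    = gL-∧
  ; g-≤    = λ x → interior-below {x = x} (HeytingAlgebra.refl L)
  ; g-idem = λ x → ι-cong (interior-ι (interior x))
  }
  where open FreeBooleanExtension L hiding (⊤; ⊥; _∧_; _∨_; ¬_)

module _ {a ℓ₁ ℓ₂ b ℓ₃ ℓ₄ : Level}
         (L : HeytingAlgebra a ℓ₁ ℓ₂) (M : HeytingAlgebra b ℓ₃ ℓ₄)
         (h : HeytingHom L M) where
  private
    module L = HeytingAlgebra L
    module M = HeytingAlgebra M
    module FL = FreeBooleanExtension L
    module FM = FreeBooleanExtension M
    module h = Hom h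

    ιh : LatticeHom L FM.frBoolean
    ιh = record
      { fun    = λ x → ι (h.fun x)
      ; cong   = λ p → FM.ι-cong (h.cong p)
      ; ∧-homo = λ x y → FM.≋-trans (FM.ι-cong (h.homo `∧ (x ∷ᵥ y ∷ᵥ []ᵥ))) (FM.ι-∧ _ _)
      ; ∨-homo = λ x y → FM.≋-trans (FM.ι-cong (h.homo `∨ (x ∷ᵥ y ∷ᵥ []ᵥ))) (FM.ι-∨ _ _)
      ; ⊤-homo = FM.≋-trans (FM.ι-cong (h.homo `⊤ []ᵥ)) FM.ι-⊤
      ; ⊥-homo = FM.≋-trans (FM.ι-cong (h.homo `⊥ []ᵥ)) FM.ι-⊥
      }

    𝓑h : FL.Fr → FM.Fr
    𝓑h = FL.extend FM.frBoolean ιh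

    𝓑h-cong : ∀ {x y} → x FL.≋ y → 𝓑h x FM.≋ 𝓑h y
    𝓑h-cong = FL.extend-cong FM.frBoolean ιh

    mapClauses : FL.Clauses → FM.Clauses
    mapClauses = map (λ (u , v) → h.fun u , h.fun v)

    𝓑h-∏ : ∀ cs → 𝓑h (FL.∏ cs) FM.≋ FM.∏ (mapClauses cs)
    𝓑h-∏ []       = FM.≋-refl
    𝓑h-∏ (_ ∷ cs) = FM.∧-cong FM.≋-refl (𝓑h-∏ cs)

    h-∏⇨ : ∀ cs → h.fun (FL.∏⇨ cs) M.≈ FM.∏⇨ (mapClauses cs)
    h-∏⇨ []             = h.homo `⊤ []ᵥ
    h-∏⇨ ((u , v) ∷ cs) = M.Eq.trans (h.homo `∧ ((u L.⇨ v) ∷ᵥ FL.∏⇨ cs ∷ᵥ []ᵥ))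
      (MeetProperties.∧-cong M.meetSemilattice (h.homo `⇨ (u ∷ᵥ v ∷ᵥ []ᵥ)) (h-∏⇨ cs))

    h-interior : ∀ x → h.fun (FL.interior x) M.≈ FM.interior (𝓑h x)
    h-interior x = begin
      h.fun (FL.∏⇨ (FL.cnf x))                    ≈⟨ h-∏⇨ (FL.cnf x) ⟩
      FM.∏⇨ (mapClauses (FL.cnf x))               ≈⟨ FM.interior-∏ (mapClauses (FL.cnf x)) ⟨
      FM.interior (FM.∏ (mapClauses (FL.cnf x)))  ≈⟨ FM.interior-cong (𝓑h-∏ (FL.cnf x)) ⟨
      FM.interior (𝓑h (FL.∏ (FL.cnf x)))          ≈⟨ FM.interior-cong (𝓑h-cong (FL.∏-cnf x)) ⟩
      FM.interior (𝓑h x)                          ∎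
      where open ≈-Reasoning M.setoid

  𝓑₁ : InteriorHom (𝓑 L) (𝓑 M)
  𝓑₁ = record
    { fun  = 𝓑h
    ; cong = 𝓑h-cong
    ; homo = λ where
        `∧ _  → FM.≋-refl
        `∨ _  → FM.≋-refl
        `¬ _  → FM.≋-refl
        `⊤ _  → FM.≋-refl
        `⊥ _  → FM.≋-refl
        `g xs → FM.ι-cong (h-interior (xs zero))
    }

  𝓑₁-extends : ∀ a → Hom.fun 𝓑₁ (ι a) FM.≋ ι (h.fun a)
  𝓑₁-extends a = FM.≋-refl

  𝓑₁-unique : (k : InteriorHom (𝓑 L) (𝓑 M)) →
              (∀ a → Hom.fun k (ι a) FM.≋ ι (h.fun a)) →
              ∀ x → Hom.fun k x FM.≋ Hom.fun 𝓑₁ x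
  𝓑₁-unique k k-ext = go
    where
    module k = Hom k
    go : ∀ x → k.fun x FM.≋ 𝓑h x
    go (ι a)   = k-ext a
    go (x ∧ y) = FM.≋-trans (k.homo `∧ (x ∷ᵥ y ∷ᵥ []ᵥ)) (FM.∧-cong (go x) (go y))
    go (x ∨ y) = FM.≋-trans (k.homo `∨ (x ∷ᵥ y ∷ᵥ []ᵥ)) (FM.∨-cong (go x) (go y))
    go (¬ x)   = FM.≋-trans (k.homo `¬ (x ∷ᵥ []ᵥ)) (FM.¬-cong (go x))
    go ⊤       = k.homo `⊤ []ᵥ
    go ⊥       = k.homo `⊥ []ᵥ

data IsImage𝓑 (ℓ : Level) {e : Level} (V : Variety (HeytingAlgebras ℓ) e)
              : Pred (InteriorAlgebra ℓ ℓ) (lsuc ℓ ⊔ e) where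
  image : (L : HeytingAlgebra ℓ ℓ ℓ) → _∈ᵥ_ (HeytingAlgebras ℓ) L V → IsImage𝓑 ℓ V (𝓑 L)

ρ* : (ℓ : Level) {e : Level} → Variety (HeytingAlgebras ℓ) e → Variety (InteriorAlgebras ℓ) (lsuc ℓ ⊔ e)
ρ* ℓ V = generatedBy (InteriorAlgebras ℓ) (IsImage𝓑 ℓ V)

{-# OPTIONS --safe #-}

-- 𝓑 is left adjoint to the functor 𝓞 taking an interior algebra to the Heyting
-- algebra of its open elements, and 𝓞 (𝓑 L) ≅ L.  By the Gödel translation, 𝓞 A
-- lies in V as soon as A lies in ρ*(V).  Since 𝓞 preserves surjections, 𝓑 preserves
-- projectivity; and if L is presented by generators xᵢ and relations s = t, then
-- 𝓑 L is presented by the generators xᵢ, the relations xᵢ = g xᵢ and the Gödel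
-- translations of the relations s = t.
module Submission where

open import Defs
open import Level using (Level; _⊔_) renaming (suc to lsuc)
open import Data.Fin using (Fin; zero; suc)
open import Data.List using (List; []; _∷_; _++_; map; allFin)
open import Data.List.Membership.Propositional using (_∈_)
open import Data.List.Membership.Propositional.Properties using (∈-++⁺ˡ; ∈-++⁺ʳ; ∈-++⁻; ∈-map⁺; ∈-map⁻; ∈-allFin)
open import Data.Nat using (ℕ)
open import Data.Product using (_×_; _,_; proj₁; proj₂)
open import Data.Sum using (inj₁; inj₂)
open import Data.Vec.Functional using () renaming ([] to []ᵥ; _∷_ to _∷ᵥ_)
open import Function.Definitions using (Surjective)
open import Algebra.Lattice.Structures.Biased using (isDistributiveLatticeʳʲᵐ; isBooleanAlgebraʳ)
open import Relation.Binary.Lattice using (HeytingAlgebra; Lattice)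
open import Relation.Binary.PropositionalEquality as ≡ using (_≡_)
import Algebra.Lattice.Properties.BooleanAlgebra as BooleanProperties
import Relation.Binary.Reasoning.Setoid as ≈-Reasoning

private
  variable
    a b c ℓ ℓ₁ ℓ₂ ℓ₃ : Level

-- Interior algebras and their Heyting algebras of open elements.

module InteriorProperties (A : InteriorAlgebra c ℓ) where
  open InteriorAlgebra A
  open BooleanProperties booleanAlgebra using (∧-identityʳ; ∧-zeroʳ; ∨-∧-orderTheoreticLattice)
  module ≤ = Lattice ∨-∧-orderTheoreticLattice

  -- Splits `x` along `¬ y ∨ y ≈ ⊤`. With `transpose-∧` this is Boolean residuation, from which the
  -- exponential of `𝓞` is obtained.
  transpose-∨ : ∀ {x y z} → (x ∧ y) ≤ z → x ≤ (¬ y ∨ z)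
  transpose-∨ {x} {y} {z} p =
    ≤.trans (≤.reflexive (trans (sym (∧-identityʳ x))
              (trans (∧-congˡ (sym (∨-complementˡ y))) (∧-distribˡ-∨ x (¬ y) y))))
            (≤.∨-least (≤.trans (≤.x∧y≤y _ _) (≤.x≤x∨y _ _)) (≤.trans p (≤.y≤x∨y _ _)))

  transpose-∧ : ∀ {x y z} → x ≤ (¬ y ∨ z) → (x ∧ y) ≤ z
  transpose-∧ {x} {y} {z} p =
    ≤.trans (≤.∧-greatest (≤.trans (≤.x∧y≤x _ _) p) (≤.x∧y≤y _ _))
    (≤.trans (≤.reflexive (∧-distribʳ-∨ y (¬ y) z))
    (≤.∨-least (≤.trans (≤.reflexive (trans (∧-complementˡ y) (sym (∧-complementʳ z)))) (≤.x∧y≤x _ _))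
               (≤.x∧y≤x _ _)))

  -- Since `x ≤ y` unfolds to `x ≈ x ∧ y`, inequalities are used as equations here and in `g-⊥`.
  g-mono : ∀ {x y} → x ≤ y → g x ≤ g y
  g-mono p = trans (g-cong p) (g-∧ _ _)

  g-⊥ : g ⊥ ≈ ⊥
  g-⊥ = trans (g-≤ ⊥) (∧-zeroʳ (g ⊥))

  g-∨-open : ∀ x y → g (g x ∨ g y) ≈ g x ∨ g y
  g-∨-open x y = ≤.antisym (g-≤ _)
    (≤.∨-least (≤.trans (≤.reflexive (sym (g-idem x))) (g-mono (≤.x≤x∨y _ _)))
               (≤.trans (≤.reflexive (sym (g-idem y))) (g-mono (≤.y≤x∨y _ _))))

-- The open elements are represented as a quotient of A, every x standing for g x.
𝓞 : InteriorAlgebra c ℓ → HeytingAlgebra c ℓ ℓ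
𝓞 A = record
  { Carrier = Carrier
  ; _≈_ = λ x y → g x ≈ g y
  ; _≤_ = λ x y → g x ≤ g y
  ; _∨_ = λ x y → g x ∨ g y
  ; _∧_ = _∧_
  ; _⇨_ = λ x y → ¬ g x ∨ g y
  ; ⊤ = ⊤
  ; ⊥ = ⊥
  ; isHeytingAlgebra = record
    { isBoundedLattice = record
      { isLattice = record
        { isPartialOrder = record
          { isPreorder = record
            { isEquivalence = record { refl = refl ; sym = sym ; trans = trans }
            ; reflexive = ≤.reflexive
            ; trans = ≤.trans
            }
          ; antisym = ≤.antisym
          }
        ; supremum = λ x y →
            ≤.trans (≤.x≤x∨y _ _) (≤.reflexive (sym (g-∨-open x y)))
          , ≤.trans (≤.y≤x∨y _ _) (≤.reflexive (sym (g-∨-open x y)))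
          , λ z p q → ≤.trans (g-≤ _) (≤.∨-least p q)
        ; infimum = λ x y →
            g-mono (≤.x∧y≤x x y)
          , g-mono (≤.x∧y≤y x y)
          , λ z p q → ≤.trans (≤.∧-greatest p q) (≤.reflexive (sym (g-∧ x y)))
        }
      ; maximum = λ x → g-mono (sym (∧-identityʳ x))
      ; minimum = λ x → g-mono (≤.trans (≤.reflexive (sym (∧-complementʳ x))) (≤.x∧y≤x _ _))
      }
    -- Boolean residuation, plus the fact that the open element `g w` lies below `¬ g x ∨ g y`
    -- exactly when it lies below the interior of that element.
    ; exponential = λ w x y →
        (λ p → ≤.trans (≤.reflexive (sym (g-idem w)))
                 (g-mono (transpose-∨ (≤.trans (≤.reflexive (sym (g-∧ w x))) p))))
      , (λ p → ≤.trans (≤.reflexive (g-∧ w x)) (transpose-∧ (≤.trans p (g-≤ _))))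
    }
  }
  where
  open InteriorAlgebra A
  open InteriorProperties A
  open BooleanProperties booleanAlgebra using (∧-identityʳ)

-- Commuting with `g` makes the unchanged function respect the coarser equality of open elements.
𝓞₁ : (A : InteriorAlgebra a ℓ₁) (B : InteriorAlgebra b ℓ₂) →
     InteriorHom A B → HeytingHom (𝓞 A) (𝓞 B)
𝓞₁ A B f = record
  { fun = f.fun
  ; cong = λ {x} {y} p → trans (sym (f-g x)) (trans (f.cong p) (f-g y))
  ; homo = λ where
      `∧ xs → g-cong (f-∧ _ _)
      `∨ xs → g-cong (trans (f-∨ _ _) (∨-cong (f-g _) (f-g _)))
      `⇨ xs → g-cong (trans (f-∨ _ _)
                (∨-cong (trans (f.homo `¬ (_ ∷ᵥ []ᵥ)) (¬-cong (f-g _))) (f-g _)))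
      `⊤ xs → g-cong (f.homo `⊤ []ᵥ)
      `⊥ xs → g-cong (f.homo `⊥ []ᵥ)
  }
  where
  module A = InteriorAlgebra A
  open InteriorAlgebra B
  module f = Hom f
  f-g : ∀ x → f.fun (A.g x) ≈ g (f.fun x)
  f-g x = f.homo `g (x ∷ᵥ []ᵥ)
  f-∧ : ∀ x y → f.fun (x A.∧ y) ≈ f.fun x ∧ f.fun y
  f-∧ x y = f.homo `∧ (x ∷ᵥ y ∷ᵥ []ᵥ)
  f-∨ : ∀ x y → f.fun (x A.∨ y) ≈ f.fun x ∨ f.fun y
  f-∨ x y = f.homo `∨ (x ∷ᵥ y ∷ᵥ []ᵥ)

-- The same preimage works, as the equality to be met in `𝓞 B` is only weaker.
𝓞₁-surjective : (A : InteriorAlgebra a ℓ₁) (B : InteriorAlgebra b ℓ₂) (f : InteriorHom A B) →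
                Surjective (InteriorAlgebra._≈_ A) (InteriorAlgebra._≈_ B) (Hom.fun f) →
                Surjective (HeytingAlgebra._≈_ (𝓞 A)) (HeytingAlgebra._≈_ (𝓞 B)) (Hom.fun (𝓞₁ A B f))
𝓞₁-surjective A B f surj y with surj y
... | x , fx≈y = x , λ p → B.trans (Hom.cong (𝓞₁ A B f) p) (B.g-cong (fx≈y A.refl))
  where
  module A = InteriorAlgebra A
  module B = InteriorAlgebra B

-- Homomorphisms, term evaluation and quotients.

infixr 9 _∘ₕ_
_∘ₕ_ : {S : Signature} {A : Algebra S a ℓ₁} {B : Algebra S b ℓ₂} {C : Algebra S c ℓ₃} →
       Hom B C → Hom A B → Hom A C
_∘ₕ_ {C = C} k h = record
  { fun  = λ x → k.fun (h.fun x)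
  ; cong = λ p → k.cong (h.cong p)
  ; homo = λ o xs → Algebra.trans C (k.cong (h.homo o xs)) (k.homo o _)
  }
  where
  module k = Hom k
  module h = Hom h

hom-eval : {S : Signature} {A : Algebra S a ℓ₁} {B : Algebra S b ℓ₂} (h : Hom A B) {X : Set}
           (ρ : X → Algebra.Carrier A) (t : Term S X) →
           Algebra._≈_ B (Hom.fun h (eval A ρ t)) (eval B (λ x → Hom.fun h (ρ x)) t)
hom-eval {B = B} h ρ (var x)     = Algebra.refl B
hom-eval {B = B} h ρ (node o ts) =
  Algebra.trans B (Hom.homo h o _) (Algebra.op-cong B o (λ i → hom-eval h ρ (ts i)))

-- The kernel of `h` is a congruence, so it suffices that it contains the generating pairs.
factor-Cg : {S : Signature} (F : Algebra S a ℓ₁) (R : List (Algebra.Carrier F × Algebra.Carrier F))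
          (B : Algebra S b ℓ₂) (h : Hom F B) →
          (∀ {x y} → (x , y) ∈ R → Algebra._≈_ B (Hom.fun h x) (Hom.fun h y)) →
          Hom (F / R) B
factor-Cg F R B h h-rel = record { fun = h.fun ; cong = go ; homo = h.homo }
  where
  module h = Hom h
  module B = Algebra B
  go : ∀ {x y} → Cg F R x y → h.fun x B.≈ h.fun y
  go (base p)    = h.cong p
  go (rel r)     = h-rel r
  go (symm p)    = B.sym (go p)
  go (tran p q)  = B.trans (go p) (go q)
  go (congr o p) = B.trans (h.homo o _) (B.trans (B.op-cong o (λ i → go (p i))) (B.sym (h.homo o _)))

-- The Gödel translation of terms.

infixr 7 _∧ₜ_
infixr 6 _∨ₜ_

_∧ₜ_ _∨ₜ_ : {X : Set} → Term interiorSignature X → Term interiorSignature X → Term interiorSignature X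
s ∧ₜ t = node `∧ (s ∷ᵥ t ∷ᵥ []ᵥ)
s ∨ₜ t = node `∨ (s ∷ᵥ t ∷ᵥ []ᵥ)

¬ₜ gₜ : {X : Set} → Term interiorSignature X → Term interiorSignature X
¬ₜ t = node `¬ (t ∷ᵥ []ᵥ)
gₜ t = node `g (t ∷ᵥ []ᵥ)

⊤ₜ ⊥ₜ : {X : Set} → Term interiorSignature X
⊤ₜ = node `⊤ []ᵥ
⊥ₜ = node `⊥ []ᵥ

-- The Gödel translation, up to an outer g.
gödel : {X : Set} → Term heytingSignature X → Term interiorSignature X
gödel (var x)      = var x
gödel (node `∧ ts) = gödel (ts zero) ∧ₜ gödel (ts (suc zero))
gödel (node `∨ ts) = gₜ (gödel (ts zero)) ∨ₜ gₜ (gödel (ts (suc zero)))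
gödel (node `⇨ ts) = ¬ₜ (gₜ (gödel (ts zero))) ∨ₜ gₜ (gödel (ts (suc zero)))
gödel (node `⊤ ts) = ⊤ₜ
gödel (node `⊥ ts) = ⊥ₜ

-- Each clause of `gödel` spells out an operation of `𝓞`, so the agreement is on the nose; the
-- missing outer `g` comes from the equality of `𝓞 A`.
eval-gödel : (A : InteriorAlgebra c ℓ) {X : Set} (ρ : X → InteriorAlgebra.Carrier A)
             (t : Term heytingSignature X) →
             eval (interiorAlg A) ρ (gödel t) ≡ eval (heytingAlg (𝓞 A)) ρ t
eval-gödel A ρ (var x)      = ≡.refl
eval-gödel A ρ (node `∧ ts) =
  ≡.cong₂ _∧_ (eval-gödel A ρ (ts zero)) (eval-gödel A ρ (ts (suc zero)))
  where open InteriorAlgebra A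
eval-gödel A ρ (node `∨ ts) =
  ≡.cong₂ (λ x y → g x ∨ g y) (eval-gödel A ρ (ts zero)) (eval-gödel A ρ (ts (suc zero)))
  where open InteriorAlgebra A
eval-gödel A ρ (node `⇨ ts) =
  ≡.cong₂ (λ x y → ¬ g x ∨ g y) (eval-gödel A ρ (ts zero)) (eval-gödel A ρ (ts (suc zero)))
  where open InteriorAlgebra A
eval-gödel A ρ (node `⊤ ts) = ≡.refl
eval-gödel A ρ (node `⊥ ts) = ≡.refl

-- The adjunction between `𝓑` and `𝓞`.

module _ (L : HeytingAlgebra c ℓ₁ ℓ₂) where
  private
    module L = HeytingAlgebra L
    open FreeBooleanExtension L

  -- The formula for the interior of a one-clause product, with the trailing `⊤` removed on both
  -- sides.
  interior-clause : ∀ x y → interior (¬ ι x ∨ ι y) L.≈ (x L.⇨ y)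
  interior-clause x y = L.Eq.trans
    (interior-cong (≋-sym (BooleanProperties.∧-identityʳ frBoolean (¬ ι x ∨ ι y))))
    (L.Eq.trans (interior-∏ ((x , y) ∷ []))
      (L.antisym (L.x∧y≤x _ _) (L.∧-greatest L.refl (L.maximum _))))

  -- The inverse of `ιHom`, used to carry identities of `L` over to the open elements of `𝓑 L`.
  interiorHom : HeytingHom (𝓞 (𝓑 L)) L
  interiorHom = record
    { fun  = interior
    ; cong = ι-injective
    ; homo = λ where
        `∧ xs → ι-injective (≋-trans (gL-∧ (xs zero) (xs (suc zero))) (≋-sym (ι-∧ _ _)))
        `∨ xs → L.Eq.trans (interior-cong (≋-sym (ι-∨ _ _))) (interior-ι _)
        `⇨ xs → interior-clause _ _
        `⊤ xs → L.Eq.refl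
        `⊥ xs → L.Eq.trans (interior-cong (≋-sym ι-⊥)) (interior-ι L.⊥)
    }

  -- The unit of the adjunction. Elements `ι x` are open by `interior-ι`, which absorbs the inner
  -- `g` in the operations of `𝓞`.
  ιHom : HeytingHom L (𝓞 (𝓑 L))
  ιHom = record
    { fun  = ι
    ; cong = λ p → ι-cong (interior-cong (ι-cong p))
    ; homo = λ where
        `∧ xs → ι-cong (interior-cong (ι-∧ _ _))
        `∨ xs → ι-cong (interior-cong (≋-trans (ι-∨ _ _)
                  (∨-cong (ι-cong (L.Eq.sym (interior-ι _))) (ι-cong (L.Eq.sym (interior-ι _))))))
        `⇨ xs → ι-cong (L.Eq.trans (interior-ι _) (L.Eq.trans (L.Eq.sym (interior-clause _ _))
                  (interior-cong (∨-cong (¬-cong (ι-cong (L.Eq.sym (interior-ι _))))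
                                         (ι-cong (L.Eq.sym (interior-ι _)))))))
        `⊤ xs → ι-cong (interior-cong ι-⊤)
        `⊥ xs → ι-cong (interior-cong ι-⊥)
    }

  module _ (A : InteriorAlgebra a ℓ) where
    private
      module A = InteriorAlgebra A
      module AP = InteriorProperties A

    -- The elements `ι x` generate `Fr` under the Boolean operations alone, so no case for `g`
    -- arises.
    hom-unique : (h k : InteriorHom (𝓑 L) A) →
                 (∀ x → Hom.fun h (ι x) A.≈ Hom.fun k (ι x)) →
                 ∀ x → Hom.fun h x A.≈ Hom.fun k x
    hom-unique h k h≈k = go
      where
      module h = Hom h
      module k = Hom k
      go : ∀ x → h.fun x A.≈ k.fun x
      go (ι x)   = h≈k x
      go (x ∧ y) = A.trans (h.homo `∧ (x ∷ᵥ y ∷ᵥ []ᵥ))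
        (A.trans (A.∧-cong (go x) (go y)) (A.sym (k.homo `∧ (x ∷ᵥ y ∷ᵥ []ᵥ))))
      go (x ∨ y) = A.trans (h.homo `∨ (x ∷ᵥ y ∷ᵥ []ᵥ))
        (A.trans (A.∨-cong (go x) (go y)) (A.sym (k.homo `∨ (x ∷ᵥ y ∷ᵥ []ᵥ))))
      go (¬ x)   = A.trans (h.homo `¬ (x ∷ᵥ []ᵥ))
        (A.trans (A.¬-cong (go x)) (A.sym (k.homo `¬ (x ∷ᵥ []ᵥ))))
      go ⊤       = A.trans (h.homo `⊤ []ᵥ) (A.sym (k.homo `⊤ []ᵥ))
      go ⊥       = A.trans (h.homo `⊥ []ᵥ) (A.sym (k.homo `⊥ []ᵥ))

    module _ (k : HeytingHom L (𝓞 A)) where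
      private
        module k = Hom k

        gk : LatticeHom L A.booleanAlgebra
        gk = record
          { fun    = λ x → A.g (k.fun x)
          ; cong   = k.cong
          ; ∧-homo = λ x y → A.trans (k.homo `∧ (x ∷ᵥ y ∷ᵥ []ᵥ)) (A.g-∧ _ _)
          ; ∨-homo = λ x y → A.trans (k.homo `∨ (x ∷ᵥ y ∷ᵥ []ᵥ)) (AP.g-∨-open _ _)
          ; ⊤-homo = A.trans (k.homo `⊤ []ᵥ) A.g-⊤
          ; ⊥-homo = A.trans (k.homo `⊥ []ᵥ) AP.g-⊥
          }

        k̂ : Fr → A.Carrier
        k̂ = extend A.booleanAlgebra gk

        -- The reason why `k̂` commutes with `g`: meets are preserved by `g`, which leaves a single
        -- clause, and there preservation of `⇨` by `k` is exactly the claim.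
        k̂-∏ : ∀ cs → A.g (k.fun (∏⇨ cs)) A.≈ A.g (k̂ (∏ cs))
        k̂-∏ []             = k.homo `⊤ []ᵥ
        k̂-∏ ((u , v) ∷ cs) = begin
          A.g (k.fun ((u L.⇨ v) L.∧ ∏⇨ cs))            ≈⟨ k.homo `∧ (_ ∷ᵥ _ ∷ᵥ []ᵥ) ⟩
          A.g (k.fun (u L.⇨ v) A.∧ k.fun (∏⇨ cs))      ≈⟨ A.g-∧ _ _ ⟩
          A.g (k.fun (u L.⇨ v)) A.∧ A.g (k.fun (∏⇨ cs)) ≈⟨ A.∧-cong (k.homo `⇨ (u ∷ᵥ v ∷ᵥ []ᵥ)) (k̂-∏ cs) ⟩
          A.g (k̂ (clause (u , v))) A.∧ A.g (k̂ (∏ cs))  ≈⟨ A.g-∧ _ _ ⟨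
          A.g (k̂ (∏ ((u , v) ∷ cs)))                   ∎
          where open ≈-Reasoning A.setoid

      -- The transpose of `k` under the adjunction.
      extendHom : InteriorHom (𝓑 L) A
      extendHom = record
        { fun  = k̂
        ; cong = extend-cong A.booleanAlgebra gk
        ; homo = λ where
            `∧ xs → A.refl
            `∨ xs → A.refl
            `¬ xs → A.refl
            `⊤ xs → A.refl
            `⊥ xs → A.refl
            -- The conjunctive normal form reduces an arbitrary argument to a product of clauses.
            `g xs → A.trans (k̂-∏ (cnf (xs zero)))
                      (A.g-cong (extend-cong A.booleanAlgebra gk (∏-cnf (xs zero))))
        }

-- Membership and projectivity in `ρ* ℓ V`.

module _ {ℓ e : Level} (V : Variety (HeytingAlgebras ℓ) e) where

  private
    W : Variety (InteriorAlgebras ℓ) (lsuc ℓ ⊔ e)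
    W = ρ* ℓ V

    infix 4 _∈V _∈W
    _∈V : HeytingAlgebra ℓ ℓ ℓ → Set (ℓ ⊔ e)
    L ∈V = _∈ᵥ_ (HeytingAlgebras ℓ) L V
    _∈W : InteriorAlgebra ℓ ℓ → Set (lsuc ℓ ⊔ e)
    A ∈W = _∈ᵥ_ (InteriorAlgebras ℓ) A W

  𝓑-∈ : ∀ L → L ∈V → 𝓑 L ∈W
  𝓑-∈ L L∈V = generatedBy-contains (InteriorAlgebras ℓ) (IsImage𝓑 ℓ V) (image L L∈V)

  -- For an identity of `V`, the `g`-closed translations of its two sides form an identity of `W`:
  -- on a generating algebra `𝓑 L`, `interiorHom` reduces it to the original identity in `L`. Read
  -- in `A`, it is the original identity in `𝓞 A`.
  𝓞-∈ : ∀ A → A ∈W → 𝓞 A ∈V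
  𝓞-∈ A A∈W (s , t) p ρ =
    ≡.subst₂ (λ x y → g x ≈ g y) (eval-gödel A ρ s) (eval-gödel A ρ t)
      (A∈W (gₜ (gödel s) , gₜ (gödel t)) valid ρ)
    where
    open InteriorAlgebra A
    valid : W (gₜ (gödel s) , gₜ (gödel t))
    valid _ (image L L∈V) σ =
      ≡.subst₂ (λ x y → ι (interior x) ≋ ι (interior y))
        (≡.sym (eval-gödel (𝓑 L) σ s)) (≡.sym (eval-gödel (𝓑 L) σ t))
        (ι-cong
          (L.Eq.trans (hom-eval (interiorHom L) σ s)
          (L.Eq.trans (L∈V (s , t) p _) (L.Eq.sym (hom-eval (interiorHom L) σ t)))))
      where
      module L = HeytingAlgebra L
      open FreeBooleanExtension L using (interior; ι; ι-cong; _≋_)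

  -- The transpose of `h` is lifted along `𝓞₁ A B f`, and the lift is transposed back to `𝓑 M`.
  𝓑-projective : ∀ M → Projective (HeytingAlgebras ℓ) V M →
                 Projective (InteriorAlgebras ℓ) W (𝓑 M)
  𝓑-projective M proj A B A∈W B∈W f f-surj h = k̂ , hom-unique M B (f ∘ₕ k̂) h agree
    where
    module B = InteriorAlgebra B
    module f = Hom f
    module h = Hom h
    open FreeBooleanExtension M using (ι; ι-cong; interior-ι)
    lift = proj (𝓞 A) (𝓞 B) (𝓞-∈ A A∈W) (𝓞-∈ B B∈W) (𝓞₁ A B f) (𝓞₁-surjective A B f f-surj)
             (𝓞₁ (𝓑 M) B h ∘ₕ ιHom M)
    k = proj₁ lift
    k̂ = extendHom M A k
    -- The lift matches `h` only after applying `g`. On the left, `k̂` supplies this `g`; on the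
    -- right, the openness of `ι x` removes it.
    agree : ∀ x → f.fun (Hom.fun k̂ (ι x)) B.≈ h.fun (ι x)
    agree x = begin
      f.fun (InteriorAlgebra.g A (Hom.fun k x))  ≈⟨ f.homo `g (_ ∷ᵥ []ᵥ) ⟩
      B.g (f.fun (Hom.fun k x))                  ≈⟨ proj₂ lift x ⟩
      B.g (h.fun (ι x))                          ≈⟨ h.homo `g (_ ∷ᵥ []ᵥ) ⟨
      h.fun (InteriorAlgebra.g (𝓑 M) (ι x))      ≈⟨ h.cong (ι-cong (interior-ι x)) ⟩
      h.fun (ι x)                                ∎
      where open ≈-Reasoning B.setoid

  -- Finite presentations of `𝓑 L`.

  module Presented (n : ℕ) (R : List (Term interiorSignature (Fin n) × Term interiorSignature (Fin n))) where
    private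
      F = Free (InteriorAlgebras ℓ) W n
      Q = F / R

      infix 4 _≈Q_
      _≈Q_ : Term interiorSignature (Fin n) → Term interiorSignature (Fin n) → Set _
      _≈Q_ = Algebra._≈_ Q

    -- Packaging the quotient as an interior algebra makes `𝓞` and `extendHom` applicable to it.
    quotientInterior : InteriorAlgebra _ _
    quotientInterior = record
      { booleanAlgebra = record
        { Carrier = Term interiorSignature (Fin n) ; _≈_ = _≈Q_
        ; _∨_ = _∨ₜ_ ; _∧_ = _∧ₜ_ ; ¬_ = ¬ₜ ; ⊤ = ⊤ₜ ; ⊥ = ⊥ₜ
        ; isBooleanAlgebra = isBooleanAlgebraʳ record
          { isDistributiveLattice = isDistributiveLatticeʳʲᵐ record
            { isLattice = record
              { isEquivalence = Algebra.isEquivalence Q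
              ; ∨-comm  = λ _ _ → base λ A _ _ → InteriorAlgebra.∨-comm A _ _
              ; ∨-assoc = λ _ _ _ → base λ A _ _ → InteriorAlgebra.∨-assoc A _ _ _
              ; ∨-cong  = λ p q → congr `∨ λ { zero → p ; (suc zero) → q }
              ; ∧-comm  = λ _ _ → base λ A _ _ → InteriorAlgebra.∧-comm A _ _
              ; ∧-assoc = λ _ _ _ → base λ A _ _ → InteriorAlgebra.∧-assoc A _ _ _
              ; ∧-cong  = λ p q → congr `∧ λ { zero → p ; (suc zero) → q }
              ; absorptive = (λ _ _ → base λ A _ _ → InteriorAlgebra.∨-absorbs-∧ A _ _)
                           , (λ _ _ → base λ A _ _ → InteriorAlgebra.∧-absorbs-∨ A _ _)
              }
            ; ∨-distribʳ-∧ = λ _ _ _ → base λ A _ _ → InteriorAlgebra.∨-distribʳ-∧ A _ _ _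
            }
          ; ∨-complementʳ = λ _ → base λ A _ _ → InteriorAlgebra.∨-complementʳ A _
          ; ∧-complementʳ = λ _ → base λ A _ _ → InteriorAlgebra.∧-complementʳ A _
          ; ¬-cong = λ p → congr `¬ λ { zero → p }
          }
        }
      ; g      = gₜ
      ; g-cong = λ p → congr `g λ { zero → p }
      ; g-⊤    = base λ A _ _ → InteriorAlgebra.g-⊤ A
      ; g-∧    = λ _ _ → base λ A _ _ → InteriorAlgebra.g-∧ A _ _
      ; g-≤    = λ _ → base λ A _ _ → InteriorAlgebra.g-≤ A _
      ; g-idem = λ _ → base λ A _ _ → InteriorAlgebra.g-idem A _
      }

    -- Not an identity of algebras: the operations agree only up to the
    -- extensional equality of argument vectors.
    fromInterior : Hom (interiorAlg quotientInterior) Q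
    fromInterior = record
      { fun  = λ t → t
      ; cong = λ p → p
      ; homo = λ where
          `∧ _ → base λ A _ _ → InteriorAlgebra.refl A
          `∨ _ → base λ A _ _ → InteriorAlgebra.refl A
          `¬ _ → base λ A _ _ → InteriorAlgebra.refl A
          `⊤ _ → base λ A _ _ → InteriorAlgebra.refl A
          `⊥ _ → base λ A _ _ → InteriorAlgebra.refl A
          `g _ → base λ A _ _ → InteriorAlgebra.refl A
      }

  -- `φ` is the transpose of the translation of terms, and `ψ` evaluates terms at the embedded
  -- generators. One composite is checked on the elements `ι x`, the other by induction on terms.
  𝓑-finitelyPresented : ∀ L → L ∈V → FinitelyPresented (HeytingAlgebras ℓ) V L →
                        FinitelyPresented (InteriorAlgebras ℓ) W (𝓑 L)
  𝓑-finitelyPresented L L∈V (n , R , iso) = n , R′ , record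
    { to       = fromInterior ∘ₕ φ
    ; from     = ψ
    ; inverseˡ = φψ
    ; inverseʳ = hom-unique L (𝓑 L) (ψ ∘ₕ (fromInterior ∘ₕ φ)) idHom ψφ
    }
    where
    module L = HeytingAlgebra L
    module BL = InteriorAlgebra (𝓑 L)
    open FreeBooleanExtension L using (ι; ι-cong; interior-ι; interior)
    module to = Hom (_≅_.to iso)
    module from = Hom (_≅_.from iso)

    FV = Free (HeytingAlgebras ℓ) V n
    FW = Free (InteriorAlgebras ℓ) W n

    opens translations : List (Term interiorSignature (Fin n) × Term interiorSignature (Fin n))
    opens = map (λ i → var i , gₜ (var i)) (allFin n)
    translations = map (λ (s , t) → gₜ (gödel s) , gₜ (gödel t)) R

    R′ = opens ++ translations

    open Presented n R′
    module Q = InteriorAlgebra quotientInterior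

    gödelHom : Hom FV (heytingAlg (𝓞 quotientInterior))
    gödelHom = record
      { fun  = gödel
      -- The equality of the quotient lives in a larger universe than that of the members of `W`, so
      -- `𝓞-∈` is applied to each test algebra `A` and not to the quotient.
      ; cong = λ {s} {t} s≈t → base λ A A∈W ρ →
          ≡.subst₂ (λ x y → InteriorAlgebra._≈_ A (InteriorAlgebra.g A x) (InteriorAlgebra.g A y))
            (≡.sym (eval-gödel A ρ s)) (≡.sym (eval-gödel A ρ t))
            (s≈t (𝓞 A) (𝓞-∈ A A∈W) ρ)
      ; homo = λ where
          `∧ _ → Q.refl
          `∨ _ → Q.refl
          `⇨ _ → Q.refl
          `⊤ _ → Q.refl
          `⊥ _ → Q.refl
      }

    gödelHom/R : Hom (FV / R) (heytingAlg (𝓞 quotientInterior))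
    gödelHom/R = factor-Cg FV R (heytingAlg (𝓞 quotientInterior)) gödelHom
      (λ r → rel (∈-++⁺ʳ opens (∈-map⁺ _ r)))

    φ : InteriorHom (𝓑 L) quotientInterior
    φ = extendHom L quotientInterior (gödelHom/R ∘ₕ _≅_.to iso)

    gen : Fin n → L.Carrier
    gen i = from.fun (var i)

    eval-gen : ∀ t → eval (heytingAlg L) gen t L.≈ from.fun t
    eval-gen (var i)     = L.Eq.refl
    eval-gen (node o ts) = L.Eq.trans (Algebra.op-cong (heytingAlg L) o (λ i → eval-gen (ts i)))
                                      (L.Eq.sym (from.homo o ts))

    ⟦_⟧ : Term interiorSignature (Fin n) → BL.Carrier
    ⟦_⟧ = eval (interiorAlg (𝓑 L)) (λ i → ι (gen i))

    -- Evaluation in `𝓞 (𝓑 L)` is pulled back to `L` along `ιHom`. This yields both the translated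
    -- relations in `𝓑 L` and the round trip `ψφ`.
    eval-gödel-gen : ∀ t → BL.g ⟦ gödel t ⟧ BL.≈ ι (from.fun t)
    eval-gödel-gen t = begin
      BL.g ⟦ gödel t ⟧
        ≡⟨ ≡.cong BL.g (eval-gödel (𝓑 L) _ t) ⟩
      ι (interior (eval (heytingAlg (𝓞 (𝓑 L))) (λ i → ι (gen i)) t))
        ≈⟨ hom-eval (ιHom L) gen t ⟨
      ι (interior (ι (eval (heytingAlg L) gen t)))
        ≈⟨ ι-cong (interior-ι _) ⟩
      ι (eval (heytingAlg L) gen t)
        ≈⟨ ι-cong (eval-gen t) ⟩
      ι (from.fun t)  ∎
      where open ≈-Reasoning BL.setoid

    ⟦⟧-rel : ∀ {x y} → (x , y) ∈ R′ → ⟦ x ⟧ BL.≈ ⟦ y ⟧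
    ⟦⟧-rel r with ∈-++⁻ opens r
    ... | inj₁ q with ∈-map⁻ _ q
    ...   | i , _ , ≡.refl = ι-cong (L.Eq.sym (interior-ι (gen i)))
    ⟦⟧-rel r | inj₂ q with ∈-map⁻ _ q
    ...   | (s , t) , st∈R , ≡.refl =
      BL.trans (eval-gödel-gen s) (BL.trans (ι-cong (from.cong (rel st∈R))) (BL.sym (eval-gödel-gen t)))

    ψ : Hom (FW / R′) (interiorAlg (𝓑 L))
    ψ = factor-Cg FW R′ (interiorAlg (𝓑 L))
      (record { fun = ⟦_⟧ ; cong = λ s≈t → s≈t (𝓑 L) (𝓑-∈ L L∈V) _
              ; homo = λ o _ → Algebra.refl (interiorAlg (𝓑 L)) })
      ⟦⟧-rel

    idHom : InteriorHom (𝓑 L) (𝓑 L)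
    idHom = record { fun = λ x → x ; cong = λ p → p ; homo = λ _ _ → Algebra.refl (interiorAlg (𝓑 L)) }

    ψφ : ∀ x → ⟦ Hom.fun φ (ι x) ⟧ BL.≈ ι x
    ψφ x = BL.trans (eval-gödel-gen (to.fun x)) (ι-cong (_≅_.inverseʳ iso x))

    φψ : ∀ t → Hom.fun φ ⟦ t ⟧ Q.≈ t
    -- The round trip produces `gₜ (var i)`; the relation from `opens` turns it back into `var i`.
    φψ (var i) = Q.trans
      (Hom.cong gödelHom/R (_≅_.inverseˡ iso (var i)))
      (Q.sym (rel (∈-++⁺ˡ (∈-map⁺ _ (∈-allFin i)))))
    φψ (node o ts) = tran (Hom.homo (fromInterior ∘ₕ φ) o _) (congr o (λ i → φψ (ts i)))

theorem5p4 : {ℓ e : Level} (V : Variety (HeytingAlgebras ℓ) e)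
    (L : HeytingAlgebra ℓ ℓ ℓ) → _∈ᵥ_ (HeytingAlgebras ℓ) L V →
    FinitelyPresented (HeytingAlgebras ℓ) V L →
    (M : HeytingAlgebra ℓ ℓ ℓ) (u : HeytingHom L M) →
    IsUnifier (HeytingAlgebras ℓ) V L M u →
    IsUnifier (InteriorAlgebras ℓ) (ρ* ℓ V) (𝓑 L) (𝓑 M) (𝓑₁ L M u)
theorem5p4 V L L∈V L-fp M u unifier = record
  { dom-member            = 𝓑-∈ V L L∈V
  ; dom-finitelyPresented = 𝓑-finitelyPresented V L L∈V L-fp
  ; cod-member            = 𝓑-∈ V M cod-member
  ; cod-finitelyPresented = 𝓑-finitelyPresented V M cod-member cod-finitelyPresented
  ; cod-projective        = 𝓑-projective V M cod-projective
  }
  where open IsUnifier unifier
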